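{- (a) The set theoretic structure of an $l$-regular $\lambda$-connected CNF formula $F=\{C_1,C_2,\dots,C_m\}$ with $m=|F|$ and variable set $Var(F)=\{a_1,\dots,a_n\}$ defines a partial $(m,l,\lambda)$-BIBD with point set $X=F=\{C_1,C_2,\dots,C_m\}$ and block set $B=\{\Phi(a_j): 1\le j\le n\}$, where $\Phi: Var(F)\to 2^F$ is given by $\Phi(a_j)=\{C_i : a_j\in Var(C_i),\ 1\le i\le m\}$. (b) Likewise, a partial $(m,l,\lambda)$-BIBD with point set $X=\{p_1,\dots,p_m\}$ and block set $B=\{b_1,\dots,b_n\}$ defines the structure of an $l$-regular $\lambda$-connected CNF formula with $F=\{\Psi(p_i): 1\le i\le m\}$ and $Var(F)=B$, where $\Psi: X\to 2^B$ is given by $\Psi(p_i)=\{b_j\in B : p_i\in b_j,\ 1\le j\le n\}$.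
   Context: All CNF formulas are assumed monotone (all literals are of one kind, either the variable or its negation), so a clause $C$ is identified with its set of variables $Var(C)$. A $\lambda$-connected CNF formula is a set $F$ of clauses $C_i$ over a variable set $Var(F)$ with $C_i\in 2^{Var(F)}$ such that any two clauses have at most $\lambda$ variables in common. It is $l$-regular if each variable occurs exactly $l$ times, i.e. in exactly $l$ clauses. A partial $(m,l,\lambda)$-BIBD (partially balanced incomplete block design) is a pair of finite sets $(X,B)$ of $m=|X|$ points and $n=|B|$ blocks such that: (i) each block is a proper subset of $X$; (ii) every block contains exactly $l<m$ points; (iii) every pair of points is contained in at most $\lambda$ blocks.
   Formalization: In (a), l<m is assumed when F has at most one clause (F={{a}}, l=1 fails). In (b), F is the indexed family of clauses Ψ(p_i), possibly repeated; F is a set of m clauses only when Ψ is injective (X={1,2,3}, B={{1,2}}, l=2 fails). -}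

module Defs where

open import Data.Fin.Base using (Fin)
open import Data.Fin.Subset using (Subset; _∈_; _⊂_; _∩_; ⊤; ∣_∣)
open import Data.Fin.Subset.Properties using (_∈?_)
open import Data.Bool.Properties using () renaming (_≟_ to _≟ᵇ_)
open import Data.List.Base using (List; length; deduplicate)
open import Data.Nat.Base using (ℕ; _≤_; _<_)
open import Data.Vec.Base using (Vec; lookup; tabulate; map; count; toList; fromList)
open import Data.Vec.Properties using (≡-dec)
open import Data.Vec.Relation.Unary.Unique.Propositional using (Unique)
open import Relation.Binary.Definitions using (DecidableEquality)
open import Relation.Binary.PropositionalEquality using (_≡_; _≢_)
open import Relation.Nullary.Decidable using (does; _×-dec_)

-- A monotone clause over the variables a_1,…,a_n is its variable set, a
-- Subset n.  A vector F : Vec (Subset n) m lists the clauses C_1,…,C_m; as a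
-- vector may repeat entries, it is a family (multiset) of clauses, and it is
-- a set of m clauses exactly when its entries are distinct (Unique).  The same
-- encoding is used for the blocks b_1,…,b_n over the points p_1,…,p_m.

record IsCNFFamily {m n : ℕ} (l lam : ℕ) (F : Vec (Subset n) m) : Set where
  field
    regular   : ∀ (a : Fin n) → count (a ∈?_) F ≡ l
    connected : ∀ (i k : Fin m) → i ≢ k → ∣ lookup F i ∩ lookup F k ∣ ≤ lam

-- l-regular lam-connected CNF formula: a set of clauses.
record IsCNF {m n : ℕ} (l lam : ℕ) (F : Vec (Subset n) m) : Set where
  field
    distinct : Unique F
    family   : IsCNFFamily l lam F

-- l < m is a condition on the parameters: it is required even if there are no
-- blocks.
record IsPartialBIBDFamily {m n : ℕ} (l lam : ℕ) (B : Vec (Subset m) n) : Set where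
  field
    proper  : ∀ (j : Fin n) → lookup B j ⊂ ⊤
    size    : ∀ (j : Fin n) → ∣ lookup B j ∣ ≡ l
    l<m     : l < m
    balance : ∀ (p q : Fin m) → p ≢ q →
              count (λ b → (p ∈? b) ×-dec (q ∈? b)) B ≤ lam

-- Partial (m,l,lam)-BIBD: a set of blocks.
record IsPartialBIBD {m n : ℕ} (l lam : ℕ) (B : Vec (Subset m) n) : Set where
  field
    distinct : Unique B
    family   : IsPartialBIBDFamily l lam B

-- Φ(a) = { C_i : a ∈ C_i }, the point C_i being represented by its index i.
Φ : ∀ {m n} → Vec (Subset n) m → Fin n → Subset m
Φ F a = map (λ C → does (a ∈? C)) F

-- Ψ(p) = { b_j : p ∈ b_j }, the variable b_j being represented by its index j.
Ψ : ∀ {m n} → Vec (Subset m) n → Fin m → Subset n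
Ψ B p = map (λ b → does (p ∈? b)) B

blocks : ∀ {m n} → Vec (Subset n) m → Vec (Subset m) n
blocks F = tabulate (Φ F)

clauses : ∀ {m n} → Vec (Subset m) n → Vec (Subset n) m
clauses B = tabulate (Ψ B)

_≟ˢ_ : ∀ {m} → DecidableEquality (Subset m)
_≟ˢ_ = ≡-dec _≟ᵇ_

-- The set { Φ(a_j) : 1 ≤ j ≤ n }, listed without repetition: since Φ need not
-- be injective, it may have fewer than n elements.
distinctBlocks : ∀ {m n} → Vec (Subset n) m → List (Subset m)
distinctBlocks F = deduplicate _≟ˢ_ (toList (blocks F))

blockSet : ∀ {m n} (F : Vec (Subset n) m) → Vec (Subset m) (length (distinctBlocks F))
blockSet F = fromList (distinctBlocks F)

{-# OPTIONS --safe #-}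
-- A family of m clauses over n variables is an m × n incidence matrix, the sets
-- Φ(a) are its columns, and Ψ is the same construction applied to blocks:
-- passing from clauses to blocks and back is transposition.  Regularity of the
-- clauses is thus the block size, and the intersections of clauses are the
-- pair counts of blocks.  If l ≥ m, every clause contains every variable, so
-- two distinct clauses force l < m.
module Submission where

open import Defs
open import Data.Bool.Base using (true; false; _∧_)
open import Data.Fin.Base using (Fin; zero; suc)
open import Data.Fin.Properties using (¬∀⟶∃¬)
open import Data.Fin.Subset using (Subset; _∈_; _⊂_; _∩_; ⊤; ∣_∣)
open import Data.Fin.Subset.Properties
  using (_∈?_; ∈⊤; ⊆⊤; ∣⊤∣≡n; ∣p∣≤n; ∣p∣≡n⇒p≡⊤; p⊆q⇒∣p∣≤∣q∣)
open import Data.List.Base as List using (List; []; _∷_)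
open import Data.List.Relation.Binary.Sublist.Propositional using (_⊆_; []; _∷_; ⊆-trans)
open import Data.List.Relation.Binary.Sublist.Propositional.Properties
  using (filter-⊆; filter⁺; length-mono-≤)
import Data.List.Relation.Unary.All.Properties as ListAll
open import Data.List.Relation.Unary.AllPairs using ([]; _∷_)
open import Data.List.Relation.Unary.Unique.DecPropositional.Properties using (deduplicate-!)
import Data.List.Relation.Unary.Unique.Propositional as ListUnique
open import Data.Nat.Base using (ℕ; suc; _≤_; _<_; s≤s)
open import Data.Nat.Properties
  using (_<?_; ≮⇒≥; <⇒≱; ≤-trans; ≤-antisym; ≤-<-connex; module ≤-Reasoning)
open import Data.Product.Base using (_×_; _,_; proj₁; proj₂)
open import Data.Sum.Base using ([_,_]′)
open import Data.Vec.Base using (Vec; []; _∷_; lookup; map; count; toList; fromList)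
open import Data.Vec.Properties
  using (lookup-map; lookup∘tabulate; tabulate∘lookup; tabulate-cong; lookup-replicate;
         toList∘fromList)
import Data.Vec.Relation.Unary.All.Properties as VecAll
open import Data.Vec.Relation.Unary.AllPairs using ([]; _∷_)
open import Data.Vec.Relation.Unary.Unique.Propositional using (Unique)
open import Data.Vec.Relation.Unary.Unique.Propositional.Properties
  using (tabulate⁺; lookup-injective)
open import Function.Base using (_∘_)
open import Function.Definitions using (Injective)
open import Level using (0ℓ)
open import Relation.Binary.Core using (Rel)
import Relation.Binary.Definitions as Binary
open import Relation.Binary.PropositionalEquality
  using (_≡_; _≗_; refl; sym; trans; cong; cong₂; subst; module ≡-Reasoning)
open import Relation.Nullary.Decidable using (does; yes; no; ¬?; _×-dec_)
open import Relation.Nullary.Negation using (¬_; contradiction)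
open import Relation.Unary using (Pred; Decidable)

private
  variable
    A : Set
    m n l lam : ℕ

lookup-ext : {xs ys : Vec A n} → lookup xs ≗ lookup ys → xs ≡ ys
lookup-ext {xs = xs} {ys} eq =
  trans (sym (tabulate∘lookup xs)) (trans (tabulate-cong eq) (tabulate∘lookup ys))

does-∈? : ∀ (x : Fin n) p → does (x ∈? p) ≡ lookup p x
does-∈? zero    (true  ∷ p) = refl
does-∈? zero    (false ∷ p) = refl
does-∈? (suc x) (_     ∷ p) = does-∈? x p

lookup-Φ : ∀ (F : Vec (Subset n) m) a i → lookup (Φ F a) i ≡ lookup (lookup F i) a
lookup-Φ F a i = trans (lookup-map i _ F) (does-∈? a (lookup F i))

-- Transposing twice is the identity. Since `Ψ` and `Φ` unfold to the same term, this also serves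
-- for `clauses`.
Φ-blocks : ∀ (F : Vec (Subset n) m) i → Φ (blocks F) i ≡ lookup F i
Φ-blocks F i = lookup-ext λ a → begin
  lookup (Φ (blocks F) i) a       ≡⟨ lookup-Φ (blocks F) i a ⟩
  lookup (lookup (blocks F) a) i  ≡⟨ cong (λ b → lookup b i) (lookup∘tabulate (Φ F) a) ⟩
  lookup (Φ F a) i                ≡⟨ lookup-Φ F a i ⟩
  lookup (lookup F i) a           ∎
  where open ≡-Reasoning

count≡∣map∣ : ∀ {P : Pred A 0ℓ} (P? : Decidable P) (xs : Vec A n) →
              count P? xs ≡ ∣ map (does ∘ P?) xs ∣
count≡∣map∣ P? []       = refl
count≡∣map∣ P? (x ∷ xs) with does (P? x)
... | true  = cong suc (count≡∣map∣ P? xs)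
... | false = count≡∣map∣ P? xs

∣Φ∣≡count : ∀ (F : Vec (Subset n) m) a → ∣ Φ F a ∣ ≡ count (a ∈?_) F
∣Φ∣≡count F a = sym (count≡∣map∣ (a ∈?_) F)

map-∧ : ∀ (F : Vec (Subset n) m) a b →
        map (λ C → does (a ∈? C) ∧ does (b ∈? C)) F ≡ Φ F a ∩ Φ F b
map-∧ []      a b = refl
map-∧ (C ∷ F) a b = cong (_ ∷_) (map-∧ F a b)

-- `does` of a `×-dec` computes to `∧`, and `∩` is entrywise `∧`, so the decisions for the pair form
-- the intersection of two columns.
count-pair : ∀ (F : Vec (Subset n) m) a b →
             count (λ C → (a ∈? C) ×-dec (b ∈? C)) F ≡ ∣ Φ F a ∩ Φ F b ∣
count-pair F a b = trans (count≡∣map∣ _ F) (cong ∣_∣ (map-∧ F a b))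

-- Strict inclusion asks for an explicit missing point. Decidable membership over a finite type
-- extracts one from the impossibility of `p` being full.
∣p∣<n⇒p⊂⊤ : (p : Subset n) → ∣ p ∣ < n → p ⊂ ⊤
∣p∣<n⇒p⊂⊤ {n} p ∣p∣<n = ⊆⊤ {p = p} , x , ∈⊤ , x∉p
  where
  ¬full : ¬ (∀ x → x ∈ p)
  ¬full full = <⇒≱ ∣p∣<n
    (subst (_≤ ∣ p ∣) (∣⊤∣≡n n) (p⊆q⇒∣p∣≤∣q∣ {p = ⊤} {q = p} (λ {x} _ → full x)))

  missing = ¬∀⟶∃¬ n (_∈ p) (_∈? p) ¬full
  x       = proj₁ missing
  x∉p     = proj₂ missing

count-toList : ∀ {P : Pred A 0ℓ} (P? : Decidable P) (xs : Vec A n) →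
               count P? xs ≡ List.length (List.filter P? (toList xs))
count-toList P? []       = refl
count-toList P? (x ∷ xs) with does (P? x)
... | true  = cong suc (count-toList P? xs)
... | false = count-toList P? xs

-- Here `⊆` is the sublist relation, which respects multiplicity; inclusion of members alone would
-- not bound counts.
deduplicate-⊆ : ∀ {R : Rel A 0ℓ} (R? : Binary.Decidable R) (xs : List A) →
                List.deduplicate R? xs ⊆ xs
deduplicate-⊆ R? []       = []
deduplicate-⊆ R? (x ∷ xs) =
  refl ∷ ⊆-trans (filter-⊆ (¬? ∘ R? x) (List.deduplicate R? xs)) (deduplicate-⊆ R? xs)

count-deduplicate : ∀ {P : Pred A 0ℓ} (P? : Decidable P) {R : Rel A 0ℓ} (R? : Binary.Decidable R)
                    (xs : Vec A n) →
                    count P? (fromList (List.deduplicate R? (toList xs))) ≤ count P? xs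
count-deduplicate P? R? xs = begin
  count P? (fromList ys)                            ≡⟨ count-toList P? (fromList ys) ⟩
  List.length (List.filter P? (toList (fromList ys)))
    ≡⟨ cong (List.length ∘ List.filter P?) (toList∘fromList ys) ⟩
  List.length (List.filter P? ys)
    ≤⟨ length-mono-≤ (filter⁺ P? P? (λ { refl p → p }) (deduplicate-⊆ R? (toList xs))) ⟩
  List.length (List.filter P? (toList xs))          ≡⟨ count-toList P? xs ⟨
  count P? xs                                       ∎
  where
  open ≤-Reasoning
  ys = List.deduplicate R? (toList xs)

fromList-! : {xs : List A} → ListUnique.Unique xs → Unique (fromList xs)
fromList-! []           = []
fromList-! (x∉xs ∷ xs!) = VecAll.fromList⁺ x∉xs ∷ fromList-! xs!

-- Properness and size are conditions on single blocks and pass to the surviving ones; pair counts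
-- can only drop when repetitions are discarded. This handles a `Φ` that is not injective.
deduplicate-isPartialBIBD :
  (B : Vec (Subset m) n) → IsPartialBIBDFamily l lam B →
  IsPartialBIBD l lam (fromList (List.deduplicate _≟ˢ_ (toList B)))
deduplicate-isPartialBIBD {m} B isFamily = record
  { distinct = fromList-! (deduplicate-! _≟ˢ_ (toList B))
  ; family   = record
    { proper  = inherit (_⊂ ⊤) proper
    ; size    = inherit (λ b → ∣ b ∣ ≡ _) size
    ; l<m     = l<m
    ; balance = λ p q p≢q → ≤-trans (count-deduplicate _ _≟ˢ_ B) (balance p q p≢q)
    }
  }
  where
  open IsPartialBIBDFamily isFamily
  inherit : (P : Pred (Subset m) 0ℓ) → (∀ j → P (lookup B j)) →
            ∀ j → P (lookup (fromList (List.deduplicate _≟ˢ_ (toList B))) j)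
  inherit P PB = VecAll.lookup⁺ {P = P}
    (VecAll.fromList⁺ (ListAll.deduplicate⁺ _≟ˢ_ (VecAll.toList⁺ (VecAll.lookup⁻ {xs = B} PB))))

blocks-isPartialBIBDFamily :
  (F : Vec (Subset n) m) → IsCNFFamily l lam F → l < m → IsPartialBIBDFamily l lam (blocks F)
blocks-isPartialBIBDFamily {n = n} {l = l} {lam} F isFamily l<m = record
  { proper  = λ j → ∣p∣<n⇒p⊂⊤ _ (subst (_< _) (sym (size j)) l<m)
  ; size    = size
  ; l<m     = l<m
  ; balance = λ p q p≢q → subst (_≤ lam) (sym (pair p q)) (connected p q p≢q)
  }
  where
  open IsCNFFamily isFamily
  size : ∀ j → ∣ lookup (blocks F) j ∣ ≡ l
  size j = trans (cong ∣_∣ (lookup∘tabulate (Φ F) j)) (trans (∣Φ∣≡count F j) (regular j))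

  pair : ∀ p q → count (λ b → (p ∈? b) ×-dec (q ∈? b)) (blocks F) ≡ ∣ lookup F p ∩ lookup F q ∣
  -- The column of the transposed matrix at point `p` is the clause with index `p`.
  pair p q = trans (count-pair (blocks F) p q)
                   (cong₂ (λ C D → ∣ C ∩ D ∣) (Φ-blocks F p) (Φ-blocks F q))

-- `clauses B` is definitionally `blocks B`, so the lemmas on `Φ` apply with blocks in the role of
-- clauses.
clauses-isCNFFamily :
  (B : Vec (Subset m) n) → IsPartialBIBDFamily l lam B → IsCNFFamily l lam (clauses B)
clauses-isCNFFamily {lam = lam} B isFamily = record
  { regular   = λ a → trans (sym (∣Φ∣≡count (clauses B) a))
                            (trans (cong ∣_∣ (Φ-blocks B a)) (size a))
  ; connected = λ i k i≢k → subst (_≤ lam) (pair i k) (balance i k i≢k)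
  }
  where
  open IsPartialBIBDFamily isFamily
  pair : ∀ i k → count (λ b → (i ∈? b) ×-dec (k ∈? b)) B ≡
                 ∣ lookup (clauses B) i ∩ lookup (clauses B) k ∣
  pair i k = trans (count-pair B i k)
    (sym (cong₂ (λ C D → ∣ C ∩ D ∣) (lookup∘tabulate (Ψ B) i) (lookup∘tabulate (Ψ B) k)))

-- A column has `m` entries, so containing `l ≥ m` points makes it full; with all columns full, all
-- rows are. For `n = 0` the only clause is the empty vector, which is `⊤`.
m≤l⇒lookup≡⊤ : (F : Vec (Subset n) m) → IsCNFFamily l lam F → m ≤ l → ∀ i → lookup F i ≡ ⊤
m≤l⇒lookup≡⊤ {m = m} {l = l} F isFamily m≤l i = lookup-ext λ a → begin
  lookup (lookup F i) a  ≡⟨ lookup-Φ F a i ⟨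
  lookup (Φ F a) i       ≡⟨ cong (λ p → lookup p i) (∣p∣≡n⇒p≡⊤ {p = Φ F a} (∣Φ∣≡m a)) ⟩
  lookup ⊤ i             ≡⟨ lookup-replicate i true ⟩
  true                   ≡⟨ lookup-replicate a true ⟨
  lookup ⊤ a             ∎
  where
  open ≡-Reasoning
  open IsCNFFamily isFamily
  ∣Φ∣≡m : ∀ a → ∣ Φ F a ∣ ≡ m
  ∣Φ∣≡m a = ≤-antisym (∣p∣≤n (Φ F a))
    (subst (m ≤_) (sym (trans (∣Φ∣≡count F a) (regular a))) m≤l)

isCNF⇒l<m : (F : Vec (Subset n) m) → IsCNF l lam F → 2 ≤ m → l < m
-- Matching on `2 ≤ m` exposes two successors in `m`, so `zero` and `suc zero` are valid clause
-- indices.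
isCNF⇒l<m {m = m} {l} F isCNF (s≤s (s≤s _)) with l <? m
... | yes l<m = l<m
... | no  l≮m = contradiction (lookup-injective distinct zero (suc zero) F₀≡F₁) λ ()
  where
  open IsCNF isCNF
  full = m≤l⇒lookup≡⊤ F family (≮⇒≥ l≮m)
  F₀≡F₁ = trans (full zero) (sym (full (suc zero)))

mainTheorem2 : (∀ (m n l lam : ℕ) (F : Vec (Subset n) m) → IsCNF l lam F → (m ≤ 1 → l < m) →
    IsPartialBIBD l lam (blockSet F) × IsPartialBIBDFamily l lam (blocks F))
    ×
    (∀ (m n l lam : ℕ) (F : Vec (Subset n) m) → IsCNFFamily l lam F → l < m →
    IsPartialBIBDFamily l lam (blocks F))
    ×
    (∀ (m n l lam : ℕ) (B : Vec (Subset m) n) → IsPartialBIBDFamily l lam B →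
    IsCNFFamily l lam (clauses B))
    ×
    (∀ (m n l lam : ℕ) (B : Vec (Subset m) n) → IsPartialBIBD l lam B →
    Injective _≡_ _≡_ (Ψ B) → IsCNF l lam (clauses B))
mainTheorem2 =
    (λ m n l lam F isCNF small →
       -- Distinctness yields the bound only from two clauses on: a single full clause over at least
       -- one variable has `l = m = 1`. The case `m ≤ 1` therefore rests on `small`.
       let l<m      = [ small , isCNF⇒l<m F isCNF ]′ (≤-<-connex m 1)
           isFamily = blocks-isPartialBIBDFamily F (IsCNF.family isCNF) l<m
       in deduplicate-isPartialBIBD (blocks F) isFamily , isFamily)
  , (λ m n l lam → blocks-isPartialBIBDFamily)
  , (λ m n l lam → clauses-isCNFFamily)
  , (λ m n l lam B isBIBD Ψ-injective → record
      -- Two points lying in exactly the same blocks would give the same clause; injectivity of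
      -- `Ψ B` excludes this.
      { distinct = tabulate⁺ Ψ-injective
      ; family   = clauses-isCNFFamily B (IsPartialBIBD.family isBIBD)
      })
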